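{- Let $G=(V,E,\Sigma,\lambda)$ be a labeled directed graph with $n=|V|$, and let $\mathcal{G}=(N,\Sigma,P,S)$ be a context-free grammar in Chomsky normal form over the same alphabet. The saturation algorithm SatIndex-Build (defined in the context) runs on $(G,\mathcal{G})$ in $O(|P|\cdot n^3)$ time and uses $O(|N|\cdot n^2)$ space for the matrices $\{M_A\}_{A\in N}$ plus $O(|N|\cdot n^2)$ witness records. After it has terminated, the query "is there a path $\pi$ from $s$ to $t$ in $G$ with $\operatorname{tr}(\pi)\in\mathcal{L}_{\mathcal{G}}(S)$?" is answered, for any $s,t\in V$, in $O(1)$ time by reading $M_S[s,t]$.
   Context: A labeled directed graph is $G=(V,E,\Sigma,\lambda)$ with $V$ a finite set of vertices, $E\subseteq V\times V$ the directed edges, $\Sigma$ a finite alphabet, and $\lambda:E\to\Sigma$ a labeling of the edges. A path $\pi$ from $v_0$ to $v_k$ is a (possibly empty) sequence of edges $(v_0,v_1)\cdots(v_{k-1},v_k)$; the empty path at $u$ goes from $u$ to $u$. The trace is $\operatorname{tr}(\pi)=\lambda(v_0,v_1)\cdots\lambda(v_{k-1},v_k)\in\Sigma^*$. A context-free grammar is $\mathcal{G}=(N,\Sigma,P,S)$ with finite nonterminal set $N$, terminals $\Sigma$, productions $P$, start symbol $S\in N$; $\mathcal{L}_{\mathcal{G}}(A)\subseteq\Sigma^*$ is the language generated from $A\in N$. $|N|$ is the number of nonterminals and $|P|$ the number of productions. It is in Chomsky normal form (CNF) here if each production is $A\to BC$, $A\to a$, or (optionally) $S\to\varepsilon$, with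 $A,B,C\in N$, $a\in\Sigma$. Algorithm SatIndex-Build$(G,\mathcal{G})$. Maintain matrices $M_A\in\{0,1\}^{V\times V}$ for $A\in N$ (initially all $0$), a witness table $W[A,u,v]$ (initially all undefined), and a queue $Q$ (initially empty). "Insert $(A,u,v)$ with record $w$" means: if $M_A[u,v]=0$, set $M_A[u,v]\gets 1$, $W[A,u,v]\gets w$, and enqueue $(A,u,v)$; otherwise do nothing. (1) For each production $A\to a$ in $P$ and each edge $(u,v)\in E$ with $\lambda(u,v)=a$, insert $(A,u,v)$ with record $\langle\mathsf{term},(u,v)\rangle$. (2) If $S\to\varepsilon\in P$, for each $u\in V$ insert $(S,u,u)$ with record $\langle\mathsf{eps}\rangle$. (3) While $Q$ is nonempty: dequeue some $(X,i,j)$. For each production $A\to BC$ in $P$: if $X=B$, then for every $k\in V$ with $M_C[j,k]=1$ insert $(A,i,k)$ with record $\langle\mathsf{bin},B,C,j\rangle$; and if $X=C$, then for every $h\in V$ with $M_B[h,i]=1$ insert $(A,h,j)$ with record $\langle\mathsf{bin},B,C,i\rangle$. Return $\{M_A\}$ and $W$.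
   Formalization: Step (3) finds the productions mentioning X through an index built first (its cost is counted) instead of scanning all of P, which would break the time bound; the initial blank tables are not charged; the time bound is stated for n ≥ 1 and |P| ≥ 1. -}

module Defs where

open import Data.Bool.Base using (Bool; true; false; if_then_else_)
open import Data.Fin.Base using (Fin)
open import Data.Fin.Properties using (_≟_)
open import Data.List.Base using (List; []; _∷_; _++_; map; length; catMaybes; allFin)
open import Data.List.Membership.Propositional using (_∈_; mapWith∈)
open import Data.List.Relation.Unary.All using (All)
open import Data.List.Relation.Unary.Unique.Propositional using (Unique)
open import Data.Maybe.Base using (Maybe; just; nothing)
open import Data.Nat.Base using (ℕ; zero; suc)
open import Data.Product.Base using (Σ-syntax; ∃; _×_; _,_)
open import Data.Vec.Base as Vec using (Vec)
open import Relation.Binary.Construct.Closure.ReflexiveTransitive using (Star)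
open import Relation.Binary.PropositionalEquality.Core using (_≡_)
open import Relation.Nullary.Decidable.Core using (⌊_⌋)

-- Vertices are Fin n and the alphabet is Fin σ.
record LabeledGraph (n σ : ℕ) : Set where
  field
    E        : List (Fin n × Fin n)
    E-unique : Unique E
    label    : ∀ {e} → e ∈ E → Fin σ

module _ {n σ : ℕ} (G : LabeledGraph n σ) where
  open LabeledGraph G

  infixr 5 _∷_
  data Path : Fin n → Fin n → Set where
    []  : ∀ {u} → Path u u
    _∷_ : ∀ {u v w} → (u , v) ∈ E → Path v w → Path u w

  tr : ∀ {u v} → Path u v → List (Fin σ)
  tr []      = []
  tr (e ∷ π) = label e ∷ tr π

  labeledEdges : List (Fin n × Fin n × Fin σ)
  labeledEdges = mapWith∈ E λ { {u , v} e → u , v , label e }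

data Symbol (m σ : ℕ) : Set where
  nt : Fin m → Symbol m σ
  tm : Fin σ → Symbol m σ

infix 4 _⟶_
record Production (m σ : ℕ) : Set where
  constructor _⟶_
  field
    lhs : Fin m
    rhs : List (Symbol m σ)

-- Nonterminals are Fin m, so |N| = m; |P| = length P.
record CFG (m σ : ℕ) : Set where
  field
    P        : List (Production m σ)
    P-unique : Unique P
    S        : Fin m

module _ {m σ : ℕ} (𝒢 : CFG m σ) where
  open CFG 𝒢

  data _⇒_ : List (Symbol m σ) → List (Symbol m σ) → Set where
    rewriteAt : ∀ α β {A γ} → (A ⟶ γ) ∈ P → (α ++ nt A ∷ β) ⇒ (α ++ γ ++ β)

  _∈L_ : List (Fin σ) → Fin m → Set
  w ∈L A = Star _⇒_ (nt A ∷ []) (map tm w)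

  data CNFProduction : Production m σ → Set where
    binary   : ∀ {A B C} → CNFProduction (A ⟶ nt B ∷ nt C ∷ [])
    terminal : ∀ {A a} → CNFProduction (A ⟶ tm a ∷ [])
    empty    : CNFProduction (S ⟶ [])

  ChomskyNormalForm : Set
  ChomskyNormalForm = All CNFProduction P

-- The algorithm is a program of an abstract machine in which every transition
-- is a bounded number of operations of a unit-cost RAM on words that hold a
-- vertex, a symbol or a pointer.  Running time is the number of transitions.
-- Cells of the initial memory are blank on allocation.
module SatIndex {n σ m : ℕ} (G : LabeledGraph n σ) (𝒢 : CFG m σ) where
  open CFG 𝒢

  Triple : Set
  Triple = Fin m × Fin n × Fin n

  data Witness : Set where
    term : Fin n × Fin n → Witness
    eps  : Witness
    bin  : Fin m → Fin m → Fin n → Witness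

  Table : Set → Set
  Table X = Vec (Vec (Vec X n) n) m

  get : ∀ {X} → Table X → Triple → X
  get t (A , u , v) = Vec.lookup (Vec.lookup (Vec.lookup t A) u) v

  put : ∀ {X} → Table X → Triple → X → Table X
  put t (A , u , v) x =
    Vec.updateAt t A λ rows → Vec.updateAt rows u λ row → row Vec.[ v ]≔ x

  constant : ∀ {X} → X → Table X
  constant x = Vec.replicate m (Vec.replicate n (Vec.replicate n x))

  entries : ∀ {X} → Table X → List X
  entries t = Vec.toList (Vec.concat (Vec.concat t))

  cells : ∀ {X} → Table X → ℕ
  cells t = length (entries t)

  records : Table (Maybe Witness) → ℕ
  records t = length (catMaybes (entries t))

  -- (A , B , C) stands for A → BC.
  BinaryRule : Set
  BinaryRule = Fin m × Fin m × Fin m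

  record State : Set where
    field
      M    : Table Bool
      W    : Table (Maybe Witness)
      Q    : List Triple
      uses : Vec (List BinaryRule) m   -- uses[X]: the rules with X on the right
      out  : Maybe Bool                -- result register for queries
  open State

  blank : State
  blank = record
    { M    = constant false
    ; W    = constant nothing
    ; Q    = []
    ; uses = Vec.replicate m []
    ; out  = nothing
    }

  inserted : Triple → Witness → State → State
  inserted t w s =
    if get (M s) t then s
    else record s { M = put (M s) t true ; W = put (W s) t (just w) ; Q = t ∷ Q s }

  indexed : BinaryRule → State → State
  indexed r@(_ , B , C) s = record s
    { uses = if ⌊ B ≟ C ⌋ then at B (uses s) else at C (at B (uses s)) }
    where
    at : Fin m → Vec (List BinaryRule) m → Vec (List BinaryRule) m
    at X U = Vec.updateAt U X (r ∷_)

  infixr 5 _⨾_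
  data Cmd : Set where
    skip    : Cmd
    _⨾_     : Cmd → Cmd → Cmd
    inOrder : List Cmd → Cmd
    guard   : Bool → Cmd → Cmd
    whenM   : Triple → Cmd → Cmd
    insert  : Triple → Witness → Cmd
    index   : BinaryRule → Cmd
    forUses : Fin m → (BinaryRule → Cmd) → Cmd
    whileQ  : (Triple → Cmd) → Cmd
    answerM : Triple → Cmd

  forEach : {X : Set} → List X → (X → Cmd) → Cmd
  forEach xs body = inOrder (map body xs)

  Config : Set
  Config = Cmd × State

  infix 2 _↝_
  data _↝_ : Config → Config → Set where
    seq-step  : ∀ {c c′ d s s′} → (c , s) ↝ (c′ , s′) → (c ⨾ d , s) ↝ (c′ ⨾ d , s′)
    seq-skip  : ∀ {d s} → (skip ⨾ d , s) ↝ (d , s)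
    order-nil  : ∀ {s} → (inOrder [] , s) ↝ (skip , s)
    order-cons : ∀ {c cs s} → (inOrder (c ∷ cs) , s) ↝ (c ⨾ inOrder cs , s)
    guard-step : ∀ {b c s} → (guard b c , s) ↝ ((if b then c else skip) , s)
    when-step  : ∀ {t c s} → (whenM t c , s) ↝ ((if get (M s) t then c else skip) , s)
    insert-step : ∀ {t w s} → (insert t w , s) ↝ (skip , inserted t w s)
    index-step  : ∀ {r s} → (index r , s) ↝ (skip , indexed r s)
    uses-step   : ∀ {X f s} → (forUses X f , s) ↝ (forEach (Vec.lookup (uses s) X) f , s)
    while-exit  : ∀ {f s} → Q s ≡ [] → (whileQ f , s) ↝ (skip , s)
    -- Any queued triple may be dequeued.
    while-dequeue : ∀ {f s} ts {t} ts′ → Q s ≡ ts ++ t ∷ ts′ →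
                    (whileQ f , s) ↝ (f t ⨾ whileQ f , record s { Q = ts ++ ts′ })
    answer-step : ∀ {t s} → (answerM t , s) ↝ (skip , record s { out = just (get (M s) t) })

  -- Every execution from the configuration ends, after at most k transitions
  -- and without getting stuck, in a state satisfying Post.
  data Halts (Post : State → Set) : ℕ → Config → Set where
    done : ∀ {k s} → Post s → Halts Post k (skip , s)
    step : ∀ {k x} → ∃ (x ↝_) → (∀ {y} → x ↝ y → Halts Post k y) →
           Halts Post (suc k) x

  -- Testing all of P against every dequeued triple would take on the order of
  -- |N| |P| n² steps, which exceeds |P| n³ when |N| is large compared with n.
  -- Hence the binary rules are first filed under the nonterminals on their
  -- right-hand sides; that pass is part of the running time.
  indexRules : Cmd
  indexRules = forEach P λ
    { (A ⟶ nt B ∷ nt C ∷ []) → index (A , B , C)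
    ; _ → skip
    }

  terminalRules : Cmd
  terminalRules = forEach P λ
    { (A ⟶ tm a ∷ []) → forEach (labeledEdges G) λ (u , v , b) →
        guard ⌊ a ≟ b ⌋ (insert (A , u , v) (term (u , v)))
    ; _ → skip
    }

  emptyRule : Cmd
  emptyRule = forEach P λ
    { (A ⟶ []) → guard ⌊ A ≟ S ⌋ (forEach (allFin n) λ u → insert (S , u , u) eps)
    ; _ → skip
    }

  process : Triple → Cmd
  process (X , i , j) = forUses X λ (A , B , C) →
      guard ⌊ X ≟ B ⌋ (forEach (allFin n) λ k →
        whenM (C , j , k) (insert (A , i , k) (bin B C j)))
    ⨾ guard ⌊ X ≟ C ⌋ (forEach (allFin n) λ h →
        whenM (B , h , i) (insert (A , h , j) (bin B C i)))

  build : Cmd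
  build = indexRules ⨾ terminalRules ⨾ emptyRule ⨾ whileQ process

  query : Fin n → Fin n → Cmd
  query s t = answerM (S , s , t)

  HasPath : Fin n → Fin n → Set
  HasPath s t = Σ[ π ∈ Path G s t ] _∈L_ 𝒢 (tr G π) S

-- Every insertion preserves that M marks only triples (A , u , v) for which A derives the
-- trace of some path from u to v.  Conversely, whenever the loop tests
-- the queue, A → BC with (B , i , j) and (C , j , k) marked implies that (A , i , k) is
-- marked or that one of the two premises is still queued; so with an empty queue the marks
-- are closed under all productions, and induction on derivations gives completeness.
-- For the running time each triple carries a weight that covers the cost of processing it.
-- The total weight of the unmarked and the queued triples never grows, and drops by the
-- weight of t when t is dequeued.
module Submission where

open import Defs
open import Data.Bool.Base using (Bool; true; false; if_then_else_; _∨_)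
open import Data.Fin.Base using (Fin; zero; suc; combine)
open import Data.Fin.Properties using (_≟_; combine-injective; injective⇒≤)
open import Data.List.Base
  using (List; []; _∷_; _++_; map; length; lookup; allFin; cartesianProduct)
open import Data.List.Membership.Propositional using (_∈_)
open import Data.List.Membership.Propositional.Properties
  using (∈-allFin; ∈-cartesianProduct⁺; ∈-lookup; ∈-++⁺ˡ; ∈-++⁺ʳ; ∈-++⁻)
open import Data.List.Membership.Setoid.Properties using (length-mapWith∈)
open import Data.List.Properties
  using (length-map; length-++; length-tabulate; length-catMaybes; map-++; ++-assoc)
open import Data.List.Relation.Unary.All as All using (All; []; _∷_)
open import Data.List.Relation.Unary.Any using (here; there)
open import Data.List.Relation.Unary.Any.Properties using (mapWith∈⁺; mapWith∈⁻)
open import Data.List.Relation.Unary.AllPairs using (_∷_)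
open import Data.List.Relation.Unary.Unique.Propositional using (Unique)
open import Data.List.Relation.Unary.Unique.Propositional.Properties using (allFin⁺)
open import Data.Maybe.Base using (Maybe; just; nothing)
open import Data.Nat.Base using (ℕ; suc; _+_; _*_; _^_; _≤_; _<_; z≤n; s≤s; >-nonZero)
open import Data.Nat.Induction using (<-wellFounded)
open import Data.Nat.ListAction using (sum)
open import Data.Nat.ListAction.Properties using (sum-++)
open import Data.Nat.Properties hiding (_≟_)
open import Data.Nat.Tactic.RingSolver using (solve-∀)
open import Data.Product.Base using (Σ-syntax; ∃; ∃-syntax; _×_; _,_; proj₁; proj₂; map₂; uncurry)
open import Data.Sum.Base as Sum using (_⊎_; inj₁; inj₂; [_,_])
open import Data.Vec.Base as Vec using (Vec)
open import Data.Vec.Properties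
  using (lookup∘updateAt; lookup∘updateAt′; lookup-replicate; length-toList)
open import Function.Base using (_∘_; id; const)
open import Function.Bundles using (_⇔_; mk⇔)
open import Induction.WellFounded using (Acc; acc)
open import Relation.Binary.Construct.Closure.ReflexiveTransitive using (Star; ε; _◅_; _◅◅_; gmap)
open import Relation.Binary.PropositionalEquality hiding ([_])
open import Relation.Nullary.Decidable.Core using (⌊_⌋; yes; no)
open import Relation.Nullary.Negation using (contradiction)

-- Finite sums, indicators and counting

private variable
  X Y : Set

∑ : (X → ℕ) → List X → ℕ
∑ f xs = sum (map f xs)

∑-mono : {f g : X → ℕ} → (∀ x → f x ≤ g x) → ∀ xs → ∑ f xs ≤ ∑ g xs
∑-mono f≤g []       = z≤n
∑-mono f≤g (x ∷ xs) = +-mono-≤ (f≤g x) (∑-mono f≤g xs)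

-- Marking a triple lowers one summand by its weight `d` and raises none, so the whole drop survives
-- in the sum.
∑-mono-∈ : ∀ {f g : X → ℕ} {d x xs} → x ∈ xs → (∀ y → f y ≤ g y) →
           f x + d ≤ g x → ∑ f xs + d ≤ ∑ g xs
∑-mono-∈ {f = f} {g} {d} {xs = x ∷ xs} (here refl) f≤g gap = begin
  f x + ∑ f xs + d   ≡⟨ +-assoc (f x) _ d ⟩
  f x + (∑ f xs + d) ≡⟨ cong (f x +_) (+-comm _ d) ⟩
  f x + (d + ∑ f xs) ≡⟨ +-assoc (f x) d _ ⟨
  f x + d + ∑ f xs   ≤⟨ +-mono-≤ gap (∑-mono f≤g xs) ⟩
  g x + ∑ g xs       ∎
  where open ≤-Reasoning
∑-mono-∈ {f = f} {g} {d} {xs = x ∷ xs} (there x∈) f≤g gap = begin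
  f x + ∑ f xs + d   ≡⟨ +-assoc (f x) _ d ⟩
  f x + (∑ f xs + d) ≤⟨ +-mono-≤ (f≤g x) (∑-mono-∈ x∈ f≤g gap) ⟩
  g x + ∑ g xs       ∎
  where open ≤-Reasoning

∈⇒≤∑ : ∀ {f : X → ℕ} {x xs} → x ∈ xs → f x ≤ ∑ f xs
∈⇒≤∑ {f = f} {xs = x ∷ xs} (here refl) = m≤m+n (f x) (∑ f xs)
∈⇒≤∑ {f = f} {xs = x ∷ xs} (there x∈)  = m≤n⇒m≤o+n (f x) (∈⇒≤∑ x∈)

∑-≤ : ∀ {f : X → ℕ} {k} → (∀ x → f x ≤ k) → ∀ xs → ∑ f xs ≤ length xs * k
∑-≤ f≤k []       = z≤n
∑-≤ f≤k (x ∷ xs) = +-mono-≤ (f≤k x) (∑-≤ f≤k xs)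

∑-0 : (xs : List X) → ∑ (const 0) xs ≡ 0
∑-0 []       = refl
∑-0 (x ∷ xs) = ∑-0 xs

∑-+ : ∀ (f g : X → ℕ) xs → ∑ (λ x → f x + g x) xs ≡ ∑ f xs + ∑ g xs
∑-+ f g []       = refl
∑-+ f g (x ∷ xs) rewrite ∑-+ f g xs = interchange (f x) (g x) (∑ f xs) (∑ g xs)
  where
  interchange : ∀ a b c d → a + b + (c + d) ≡ a + c + (b + d)
  interchange = solve-∀

∑-*ˡ : ∀ k (f : X → ℕ) xs → ∑ (λ x → k * f x) xs ≡ k * ∑ f xs
∑-*ˡ k f []       = sym (*-zeroʳ k)
∑-*ˡ k f (x ∷ xs) rewrite ∑-*ˡ k f xs = sym (*-distribˡ-+ k (f x) (∑ f xs))

∑-comm : ∀ (f : X → Y → ℕ) xs ys →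
         ∑ (λ x → ∑ (f x) ys) xs ≡ ∑ (λ y → ∑ (λ x → f x y) xs) ys
∑-comm f []       ys = sym (∑-0 ys)
∑-comm f (x ∷ xs) ys rewrite ∑-comm f xs ys = sym (∑-+ (f x) _ ys)

∑-cartesianProduct : ∀ (f : X → ℕ) xs (ys : List Y) →
                     ∑ (f ∘ proj₁) (cartesianProduct xs ys) ≡ length ys * ∑ f xs
∑-cartesianProduct f []       ys = sym (*-zeroʳ (length ys))
∑-cartesianProduct f (x ∷ xs) ys = begin
  sum (map (f ∘ proj₁) (map (x ,_) ys ++ cartesianProduct xs ys))
    ≡⟨ cong sum (map-++ (f ∘ proj₁) (map (x ,_) ys) _) ⟩
  sum (map (f ∘ proj₁) (map (x ,_) ys) ++ map (f ∘ proj₁) (cartesianProduct xs ys))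
    ≡⟨ sum-++ (map (f ∘ proj₁) (map (x ,_) ys)) _ ⟩
  ∑ (f ∘ proj₁) (map (x ,_) ys) + ∑ (f ∘ proj₁) (cartesianProduct xs ys)
    ≡⟨ cong₂ _+_ (row ys) (∑-cartesianProduct f xs ys) ⟩
  length ys * f x + length ys * ∑ f xs
    ≡⟨ *-distribˡ-+ (length ys) (f x) (∑ f xs) ⟨
  length ys * (f x + ∑ f xs) ∎
  where
  open ≡-Reasoning
  row : ∀ zs → ∑ (f ∘ proj₁) (map (x ,_) zs) ≡ length zs * f x
  row []       = refl
  row (z ∷ zs) = cong (f x +_) (row zs)

length-cartesianProduct : (xs : List X) (ys : List Y) →
                          length (cartesianProduct xs ys) ≡ length xs * length ys
length-cartesianProduct []       ys = refl
length-cartesianProduct (x ∷ xs) ys =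
  trans (length-++ (map (x ,_) ys))
        (cong₂ _+_ (length-map (x ,_) ys) (length-cartesianProduct xs ys))

length-allFin : ∀ n → length (allFin n) ≡ n
length-allFin n = length-tabulate {n = n} id

-- The Kronecker delta, valued in `ℕ` so that counting occurrences becomes a sum whose order can be
-- exchanged.
[_≐_] : ∀ {n} → Fin n → Fin n → ℕ
[ i ≐ j ] = if ⌊ i ≟ j ⌋ then 1 else 0

[≐]-refl : ∀ {n} (i : Fin n) → [ i ≐ i ] ≡ 1
[≐]-refl i with i ≟ i
... | yes _  = refl
... | no i≢i = contradiction refl i≢i

-- `allFin n` has no repetitions, so at most one term is nonzero.
∑-[≐] : ∀ {n} (i : Fin n) → ∑ [ i ≐_] (allFin n) ≤ 1
∑-[≐] i = at-most-one (allFin⁺ _)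
  where
  absent : ∀ {js} → All (i ≢_) js → ∑ [ i ≐_] js ≡ 0
  absent []                      = refl
  absent (_∷_ {x = j} i≢j i≢js) with i ≟ j
  ... | yes i≡j = contradiction i≡j i≢j
  ... | no _    = absent i≢js

  at-most-one : ∀ {js} → Unique js → ∑ [ i ≐_] js ≤ 1
  at-most-one {[]}     _ = z≤n
  at-most-one {j ∷ js} (j∉js ∷ js!) with i ≟ j
  ... | yes refl = s≤s (≤-reflexive (absent j∉js))
  ... | no _     = at-most-one js!

-- Pigeonhole: the positions of a duplicate-free list of pairs inject into `Fin (k * l)`. This
-- bounds the number of edges by n².
Unique⇒length≤ : ∀ {k l} {ps : List (Fin k × Fin l)} → Unique ps → length ps ≤ k * l
Unique⇒length≤ {ps = ps} ps! = injective⇒≤ {f = uncurry combine ∘ lookup ps} λ eq →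
  let x≡ , y≡ = combine-injective _ _ _ _ eq in lookup-injective ps! (cong₂ _,_ x≡ y≡)
  where
  lookup-injective : ∀ {xs : List X} → Unique xs → ∀ {i j} → lookup xs i ≡ lookup xs j → i ≡ j
  lookup-injective (_ ∷ _)     {zero}  {zero}  _  = refl
  lookup-injective (x∉ ∷ _)    {zero}  {suc j} eq = contradiction eq (All.lookup x∉ (∈-lookup j))
  lookup-injective (x∉ ∷ _)    {suc i} {zero}  eq =
    contradiction (sym eq) (All.lookup x∉ (∈-lookup i))
  lookup-injective (_ ∷ xs!)   {suc i} {suc j} eq = cong suc (lookup-injective xs! eq)

-- Derivability over the graph versus paths with derivable traces

module Reachability {n σ m : ℕ} (G : LabeledGraph n σ) (𝒢 : CFG m σ) where
  open LabeledGraph G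
  open CFG 𝒢
  open SatIndex G 𝒢 using (HasPath)

  -- Parse trees laid along the graph, mentioning neither words nor paths. The constructors mirror
  -- the three ways in which the algorithm inserts a triple, so this is the least fixed point that
  -- saturation has to reach.
  data Derives : Fin m → Fin n → Fin n → Set where
    term  : ∀ {A a u v} → (A ⟶ tm a ∷ []) ∈ P → (e : (u , v) ∈ E) → label e ≡ a → Derives A u v
    eps   : ∀ {u} → (S ⟶ []) ∈ P → Derives S u u
    split : ∀ {A B C u v w} → (A ⟶ nt B ∷ nt C ∷ []) ∈ P →
            Derives B u v → Derives C v w → Derives A u w

  Derives⇒production : ∀ {A u v} → Derives A u v → ∃[ γ ] (A ⟶ γ) ∈ P
  Derives⇒production (term p _ _)  = _ , p
  Derives⇒production (eps p)       = _ , p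
  Derives⇒production (split p _ _) = _ , p

  -- A sentential form laid along a path: terminals are matched by edges, nonterminals by whole
  -- derivations. This generalises `Derives` to the intermediate forms of a rewriting sequence.
  data Spells : List (Symbol m σ) → Fin n → Fin n → Set where
    []    : ∀ {u} → Spells [] u u
    edge  : ∀ {a γ u v w} (e : (u , v) ∈ E) → label e ≡ a → Spells γ v w → Spells (tm a ∷ γ) u w
    deriv : ∀ {A γ u v w} → Derives A u v → Spells γ v w → Spells (nt A ∷ γ) u w

  Spells-++⁺ : ∀ {α β u v w} → Spells α u v → Spells β v w → Spells (α ++ β) u w
  Spells-++⁺ []           y = y
  Spells-++⁺ (edge e l x) y = edge e l (Spells-++⁺ x y)
  Spells-++⁺ (deriv d x)  y = deriv d (Spells-++⁺ x y)

  Spells-++⁻ : ∀ α {β u w} → Spells (α ++ β) u w → ∃[ v ] Spells α u v × Spells β v w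
  Spells-++⁻ []         x            = _ , [] , x
  Spells-++⁻ (tm a ∷ α) (edge e l x) =
    let v , y , z = Spells-++⁻ α x in v , edge e l y , z
  Spells-++⁻ (nt A ∷ α) (deriv d x)  =
    let v , y , z = Spells-++⁻ α x in v , deriv d y , z

  Spells-tr : ∀ {u v} (π : Path G u v) → Spells (map tm (tr G π)) u v
  Spells-tr []      = []
  Spells-tr (e ∷ π) = edge e refl (Spells-tr π)

  module _ (cnf : ChomskyNormalForm 𝒢) where

    -- Chomsky normal form leaves three shapes of right-hand side, and each corresponds to one
    -- constructor of `Derives`.
    fold-production : ∀ {A γ u v} → (A ⟶ γ) ∈ P → Spells γ u v → Derives A u v
    fold-production p x with All.lookup cnf p | x
    ... | binary   | deriv d₁ (deriv d₂ []) = split p d₁ d₂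
    ... | terminal | edge e l []            = term p e l
    ... | empty    | []                     = eps p

    -- Rewriting is undone: the segment spelled by the inserted right-hand side is cut out and
    -- folded into one derivation of the replaced nonterminal.
    Spells-⇒ : ∀ {γ δ u v} → _⇒_ 𝒢 γ δ → Spells δ u v → Spells γ u v
    Spells-⇒ (rewriteAt α β {γ = γ} p) x =
      let _ , l , mr = Spells-++⁻ α x
          _ , c , r  = Spells-++⁻ γ mr
      in Spells-++⁺ l (deriv (fold-production p c) r)

    Spells-⇒* : ∀ {γ δ u v} → Star (_⇒_ 𝒢) γ δ → Spells δ u v → Spells γ u v
    Spells-⇒* ε        x = x
    Spells-⇒* (r ◅ rs) x = Spells-⇒ r (Spells-⇒* rs x)

    -- The edges of the path spell its trace; undoing all rewrites leaves the single symbol `S`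
    -- spanning the same endpoints.
    HasPath⇒Derives : ∀ {s t} → HasPath s t → Derives S s t
    HasPath⇒Derives (π , rs) with Spells-⇒* rs (Spells-tr π)
    ... | deriv d [] = d

  ⇒-++ˡ : ∀ α {γ δ} → _⇒_ 𝒢 γ δ → _⇒_ 𝒢 (α ++ γ) (α ++ δ)
  ⇒-++ˡ α (rewriteAt α′ β {A} {γ} p) =
    subst₂ (_⇒_ 𝒢) (++-assoc α α′ _) (++-assoc α α′ _) (rewriteAt (α ++ α′) β p)

  ⇒-++ʳ : ∀ β {γ δ} → _⇒_ 𝒢 γ δ → _⇒_ 𝒢 (γ ++ β) (δ ++ β)
  ⇒-++ʳ β (rewriteAt α β′ {A} {γ} p) =
    subst₂ (_⇒_ 𝒢) (sym (++-assoc α _ β))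
      (sym (trans (++-assoc α _ β) (cong (α ++_) (++-assoc γ β′ β))))
      (rewriteAt α (β′ ++ β) p)

  _++ₚ_ : ∀ {u v w} → Path G u v → Path G v w → Path G u w
  []      ++ₚ ρ = ρ
  (e ∷ π) ++ₚ ρ = e ∷ (π ++ₚ ρ)

  tr-++ : ∀ {u v w} (π : Path G u v) (ρ : Path G v w) → tr G (π ++ₚ ρ) ≡ tr G π ++ tr G ρ
  tr-++ []      ρ = refl
  tr-++ (e ∷ π) ρ = cong (label e ∷_) (tr-++ π ρ)

  Derives⇒path : ∀ {A u v} → Derives A u v → Σ[ π ∈ Path G u v ] _∈L_ 𝒢 (tr G π) A
  Derives⇒path (term p e refl)  = e ∷ [] , rewriteAt [] [] p ◅ ε
  Derives⇒path (eps p)          = [] , rewriteAt [] [] p ◅ ε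
  Derives⇒path (split {B = B} {C} p d₁ d₂) with Derives⇒path d₁ | Derives⇒path d₂
  -- After the binary production, `B` is rewritten to its word with `C` as right context, then `C`
  -- with that finished word as left context.
  ... | π , rs | ρ , rs′ = π ++ₚ ρ , rewriteAt [] [] p ◅
    gmap (_++ (nt C ∷ [])) (⇒-++ʳ (nt C ∷ [])) rs ◅◅
    subst (Star (_⇒_ 𝒢) (map tm (tr G π) ++ (nt C ∷ []))) (sym word)
      (gmap (map tm (tr G π) ++_) (⇒-++ˡ (map tm (tr G π))) rs′)
    where
    word : map tm (tr G (π ++ₚ ρ)) ≡ map tm (tr G π) ++ map tm (tr G ρ)
    word = trans (cong (map tm) (tr-++ π ρ)) (map-++ tm (tr G π) (tr G ρ))

-- Rules for total correctness with step budgets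

module Execution {n σ m : ℕ} (G : LabeledGraph n σ) (𝒢 : CFG m σ) where
  open SatIndex G 𝒢
  open State

  private variable
    k l : ℕ
    s s′ : State
    c d : Cmd
    Post Post′ : State → Set

  Halts-mono : ∀ {x} → k ≤ l → (∀ {s} → Post s → Post′ s) → Halts Post k x → Halts Post′ l x
  Halts-mono _         f (done p)     = done (f p)
  Halts-mono (s≤s k≤l) f (step e h)   = step e λ r → Halts-mono k≤l f (h r)

  -- The budgets add up, and the additional transition is the `seq-skip` between the two commands.
  Halts-seq : Halts Post k (c , s) → (∀ {s′} → Post s′ → Halts Post′ l (d , s′)) →
              Halts Post′ (k + suc l) (c ⨾ d , s)
  Halts-seq {k = k} {l = l} (done p) next =
    Halts-mono (m≤n+m (suc l) k) id (step (_ , seq-skip) λ { seq-skip → next p })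
  Halts-seq (step ((_ , _) , r) h) next = step (_ , seq-step r) λ
    { (seq-step r′) → Halts-seq (h r′) next
    -- `seq-skip` would require the first command to be `skip`, which has no transition, whereas `r`
    -- is one.
    ; seq-skip      → contradiction r λ ()
    }

  -- The invariant is indexed by the elements still to be visited. Each element costs `order-cons`
  -- and `seq-skip` on top of its body, and the outer `suc` is the final `order-nil`.
  Halts-forEach : ∀ {body : X → Cmd} (I : List X → State → Set) {K : X → Set} →
    (∀ {x xs s} → K x → I (x ∷ xs) s → Halts (I xs) k (body x , s)) →
    ∀ {xs} → All K xs → I xs s →
    Halts (I []) (suc (length xs * (2 + k))) (forEach xs body , s)
  Halts-forEach I h [] i = step (_ , order-nil) λ { order-nil → done i }
  Halts-forEach {k = k} I h {x ∷ xs} (kx ∷ kxs) i = step (_ , order-cons) λ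
    { order-cons → Halts-mono (≤-reflexive (budget k (length xs * (2 + k)))) id
                     (Halts-seq (h kx i) (Halts-forEach I h kxs)) }
    where
    budget : ∀ k r → k + suc (suc r) ≡ 2 + k + r
    budget = solve-∀

  Halts-guard : ∀ {b} → (b ≡ true → Halts Post k (c , s)) → (b ≡ false → Post s) →
                Halts Post (suc k) (guard b c , s)
  Halts-guard {b = true}  h p = step (_ , guard-step) λ { guard-step → h refl }
  Halts-guard {b = false} h p = step (_ , guard-step) λ { guard-step → done (p refl) }

  Halts-whenM : ∀ {t} → (get (M s) t ≡ true → Halts Post k (c , s)) →
                (get (M s) t ≡ false → Post s) → Halts Post (suc k) (whenM t c , s)
  Halts-whenM {s = s} {Post = Post} {k = k} {c = c} {t} h p =
    step (_ , when-step) λ { when-step → branch (get (M s) t) refl }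
    where
    branch : ∀ b → get (M s) t ≡ b → Halts Post k ((if b then c else skip) , s)
    branch true  = h
    branch false = done ∘ p

  Halts-insert : ∀ {t w} → Post (inserted t w s) → Halts Post 1 (insert t w , s)
  Halts-insert p = step (_ , insert-step) λ { insert-step → done p }

  Halts-forUses : ∀ {A f} → Halts Post k (forEach (Vec.lookup (uses s) A) f , s) →
                  Halts Post (suc k) (forUses A f , s)
  Halts-forUses h = step (_ , uses-step) λ { uses-step → h }

  -- Amortised analysis by the potential `Φ`: an iteration with body budget `k` must leave potential
  -- at most `l`, and the 2 in `k + suc (suc l)` pays for the dequeue and the `seq-skip`. The `suc`
  -- on `Φ s` is the final exit. Since `Φ` strictly drops, well-founded recursion gives termination
  -- for every choice of dequeued triple.
  Halts-whileQ : ∀ {f} (I : State → Set) (Φ : State → ℕ) →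
    (∀ {s} ts {t} ts′ → Q s ≡ ts ++ t ∷ ts′ → I s →
      Σ[ k ∈ ℕ ] Σ[ l ∈ ℕ ] k + suc (suc l) ≤ Φ s ×
        Halts (λ s′ → I s′ × Φ s′ ≤ l) k (f t , record s { Q = ts ++ ts′ })) →
    I s → Halts (λ s′ → I s′ × Q s′ ≡ []) (suc (Φ s)) (whileQ f , s)
  Halts-whileQ {s} {f} I Φ h = loop (<-wellFounded (Φ s))
    where
    enabled : ∀ s → ∃ ((whileQ f , s) ↝_)
    enabled s with Q s in eq
    ... | []     = _ , while-exit eq
    ... | t ∷ ts = _ , while-dequeue [] ts eq

    loop : ∀ {s} → Acc _<_ (Φ s) → I s →
           Halts (λ s′ → I s′ × Q s′ ≡ []) (suc (Φ s)) (whileQ f , s)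
    loop {s} (acc rs) i = step (enabled s) λ
      { (while-exit q)            → done (i , q)
      ; (while-dequeue ts ts′ q) →
          let k , l , fits , body = h ts ts′ q i
          in Halts-mono fits id (Halts-seq body λ (i′ , Φ≤l) →
               Halts-mono (s≤s Φ≤l) id (loop
                 (rs (≤-trans (s≤s (m≤n⇒m≤1+n Φ≤l)) (≤-trans (m≤n+m _ k) fits))) i′))
      }

-- Correctness and cost of saturation, beginning with table access

module Saturation {n σ m : ℕ} (G : LabeledGraph n σ) (𝒢 : CFG m σ) where
  open LabeledGraph G
  open CFG 𝒢
  open SatIndex G 𝒢
  open State
  open Reachability G 𝒢 using (Derives; term; eps; split; Derives⇒production)
  open Execution G 𝒢

  private variable
    k : ℕ
    s s₀ s₁ s₂ : State
    t t₁ t₂ : Triple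

  Marked : State → Triple → Set
  Marked s t = get (M s) t ≡ true

  get-put : ∀ (T : Table X) t x → get (put T t x) t ≡ x
  get-put T (A , u , v) x
    rewrite lookup∘updateAt A {λ rows → Vec.updateAt rows u λ row → row Vec.[ v ]≔ x} T
          | lookup∘updateAt u {λ row → row Vec.[ v ]≔ x} (Vec.lookup T A)
          = lookup∘updateAt v (Vec.lookup (Vec.lookup T A) u)

  -- The disjunction lets each caller treat the updated cell and all other cells by one case split.
  get-put-other : ∀ (T : Table X) t x t′ → t ≡ t′ ⊎ get (put T t x) t′ ≡ get T t′
  get-put-other T (A , u , v) x (A′ , u′ , v′) with A ≟ A′
  ... | no A≢A′
    rewrite lookup∘updateAt′ A′ A {λ rows → Vec.updateAt rows u λ row → row Vec.[ v ]≔ x}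
              (A≢A′ ∘ sym) T = inj₂ refl
  ... | yes refl
    rewrite lookup∘updateAt A {λ rows → Vec.updateAt rows u λ row → row Vec.[ v ]≔ x} T
    with u ≟ u′
  ...   | no u≢u′
    rewrite lookup∘updateAt′ u′ u {λ row → row Vec.[ v ]≔ x} (u≢u′ ∘ sym) (Vec.lookup T A)
    = inj₂ refl
  ...   | yes refl
    rewrite lookup∘updateAt u {λ row → row Vec.[ v ]≔ x} (Vec.lookup T A)
    with v ≟ v′
  ...     | no v≢v′  = inj₂ (lookup∘updateAt′ v′ v (v≢v′ ∘ sym) (Vec.lookup (Vec.lookup T A) u))
  ...     | yes refl = inj₁ refl

  get-constant : ∀ (x : X) t → get (constant x) t ≡ x
  get-constant x (A , u , v)
    rewrite lookup-replicate A (Vec.replicate n (Vec.replicate n x))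
          | lookup-replicate u (Vec.replicate n x) = lookup-replicate v x

  cells≡ : (T : Table X) → cells T ≡ m * n * n
  cells≡ T = length-toList (Vec.concat (Vec.concat T))

  triples : List Triple
  triples = cartesianProduct (allFin m) (cartesianProduct (allFin n) (allFin n))

  ∈-triples : ∀ t → t ∈ triples
  ∈-triples (A , u , v) =
    ∈-cartesianProduct⁺ (∈-allFin A) (∈-cartesianProduct⁺ (∈-allFin u) (∈-allFin v))

  -- Weights of triples and the potential

  lhsCount : Fin m → ℕ
  lhsCount X = ∑ (λ p → [ Production.lhs p ≐ X ]) P

  -- A production `A → BB` counts twice for `B` although the index files it once, so this bounds the
  -- index lists from above.
  occ : Production m σ → Fin m → ℕ
  occ (_ ⟶ nt B ∷ nt C ∷ []) X = [ B ≐ X ] + [ C ≐ X ]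
  occ _                      X = 0

  occCount : Fin m → ℕ
  occCount X = ∑ (λ p → occ p X) P

  -- Two sweeps of `2 + n * 4` transitions, one transition to join them, and two of loop overhead
  -- for each rule.
  ruleCost : ℕ
  ruleCost = 7 + 8 * n

  -- Pays for dequeuing and processing a triple with nonterminal X.  The constant part is
  -- charged to the productions of X, of which a marked X has at least one, so that the
  -- weights of all triples sum to O(|P| n³) with no term in |N|.
  weight : Fin m → ℕ
  weight X = 4 * lhsCount X + ruleCost * occCount X

  unmarked : Table Bool → Triple → ℕ
  unmarked T t = if get T t then 0 else weight (proj₁ t)

  potential : State → ℕ
  potential s = ∑ (unmarked (M s)) triples + ∑ (weight ∘ proj₁) (Q s)

  -- After exchanging the sums, each production contributes at most 1, having a single left-hand
  -- side. The total is thus bounded in |P| and not in |N|.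
  ∑-lhsCount : ∑ lhsCount (allFin m) ≤ length P * 1
  ∑-lhsCount rewrite ∑-comm (λ X p → [ Production.lhs p ≐ X ]) (allFin m) P =
    ∑-≤ (λ p → ∑-[≐] (Production.lhs p)) P

  ∑-occ : ∀ p → ∑ (occ p) (allFin m) ≤ 2
  ∑-occ (_ ⟶ [])                        = ≤-trans (≤-reflexive (∑-0 (allFin m))) z≤n
  ∑-occ (_ ⟶ tm _ ∷ _)                  = ≤-trans (≤-reflexive (∑-0 (allFin m))) z≤n
  ∑-occ (_ ⟶ nt _ ∷ [])                 = ≤-trans (≤-reflexive (∑-0 (allFin m))) z≤n
  ∑-occ (_ ⟶ nt _ ∷ tm _ ∷ _)           = ≤-trans (≤-reflexive (∑-0 (allFin m))) z≤n
  ∑-occ (_ ⟶ nt B ∷ nt C ∷ [])          =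
    ≤-trans (≤-reflexive (∑-+ [ B ≐_] [ C ≐_] (allFin m))) (+-mono-≤ (∑-[≐] B) (∑-[≐] C))
  ∑-occ (_ ⟶ nt _ ∷ nt _ ∷ _ ∷ _)       = ≤-trans (≤-reflexive (∑-0 (allFin m))) z≤n

  ∑-occCount : ∑ occCount (allFin m) ≤ length P * 2
  ∑-occCount rewrite ∑-comm (λ X p → occ p X) (allFin m) P = ∑-≤ ∑-occ P

  saturationBound : ℕ
  saturationBound = n * n * (4 * (length P * 1) + ruleCost * (length P * 2))

  -- Weights ignore the vertices, so the sum over nonterminals is taken n² times; that sum is linear
  -- in |P| by double counting.
  ∑-weight≤ : ∑ (weight ∘ proj₁) triples ≤ saturationBound
  ∑-weight≤ = begin
    ∑ (weight ∘ proj₁) triples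
      ≡⟨ ∑-cartesianProduct weight (allFin m) pairs ⟩
    length pairs * ∑ weight (allFin m)
      ≡⟨ cong₂ _*_ (trans (length-cartesianProduct (allFin n) (allFin n))
                          (cong₂ _*_ (length-allFin n) (length-allFin n)))
                   (trans (∑-+ (λ X → 4 * lhsCount X) (λ X → ruleCost * occCount X) (allFin m))
                          (cong₂ _+_ (∑-*ˡ 4 lhsCount (allFin m))
                                     (∑-*ˡ ruleCost occCount (allFin m)))) ⟩
    n * n * (4 * ∑ lhsCount (allFin m) + ruleCost * ∑ occCount (allFin m))
      ≤⟨ *-monoʳ-≤ (n * n) (+-mono-≤ (*-monoʳ-≤ 4 ∑-lhsCount)
                                     (*-monoʳ-≤ ruleCost ∑-occCount)) ⟩
    saturationBound ∎
    where
    open ≤-Reasoning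
    pairs : List (Fin n × Fin n)
    pairs = cartesianProduct (allFin n) (allFin n)

  initial-potential≤ : M s ≡ constant false → Q s ≡ [] → potential s ≤ saturationBound
  initial-potential≤ {s} M≡ Q≡ rewrite M≡ | Q≡ = begin
    ∑ (unmarked (constant false)) triples + 0 ≡⟨ +-identityʳ _ ⟩
    ∑ (unmarked (constant false)) triples     ≤⟨ ∑-mono unmarked≤ triples ⟩
    ∑ (weight ∘ proj₁) triples                ≤⟨ ∑-weight≤ ⟩
    saturationBound                           ∎
    where
    open ≤-Reasoning
    unmarked≤ : ∀ t → unmarked (constant false) t ≤ weight (proj₁ t)
    unmarked≤ t rewrite get-constant false t = ≤-refl

  dequeued-potential : ∀ ts {t} ts′ → Q s ≡ ts ++ t ∷ ts′ →
    weight (proj₁ t) + potential (record s { Q = ts ++ ts′ }) ≡ potential s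
  dequeued-potential {s} ts {t} ts′ Q≡ rewrite Q≡ = begin
    w t + (U + ∑ w (ts ++ ts′))     ≡⟨ cong (λ q → w t + (U + q)) (∑-++ ts ts′) ⟩
    w t + (U + (∑ w ts + ∑ w ts′))  ≡⟨ regroup (w t) U (∑ w ts) (∑ w ts′) ⟩
    U + (∑ w ts + (w t + ∑ w ts′))  ≡⟨ cong (U +_) (∑-++ ts (t ∷ ts′)) ⟨
    U + ∑ w (ts ++ t ∷ ts′)         ∎
    where
    open ≡-Reasoning
    w = weight ∘ proj₁
    U = ∑ (unmarked (M s)) triples
    ∑-++ : ∀ xs ys → ∑ w (xs ++ ys) ≡ ∑ w xs + ∑ w ys
    ∑-++ xs ys = trans (cong sum (map-++ w xs ys)) (sum-++ (map w xs) (map w ys))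
    regroup : ∀ a b c d → a + (b + (c + d)) ≡ b + (c + (a + d))
    regroup = solve-∀

  -- Soundness and the effect of insertions

  Derived : Triple → Set
  Derived (A , u , v) = Derives A u v

  -- The queue is tracked too: a dequeued triple must be known to be derivable, both to justify the
  -- insertions it causes and to pay for processing it.
  record Sound (s : State) : Set where
    field
      marked : Marked s t → Derived t
      queued : t ∈ Q s → Derived t

  -- What holds across any stretch of execution that inserts but does not dequeue. By `fresh`,
  -- whatever was marked during the stretch is still queued at its end.
  record Grows (s s′ : State) : Set where
    field
      uses≡      : uses s′ ≡ uses s
      marked     : Marked s t → Marked s′ t
      queued     : t ∈ Q s → t ∈ Q s′
      fresh      : Marked s′ t → Marked s t ⊎ t ∈ Q s′
      potential≤ : potential s′ ≤ potential s
      sound      : Sound s′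
  open Grows

  Grows-refl : Sound s → Grows s s
  Grows-refl snd = record
    { uses≡ = refl ; marked = id ; queued = id ; fresh = inj₁ ; potential≤ = ≤-refl ; sound = snd }

  Grows-trans : Grows s₀ s₁ → Grows s₁ s₂ → Grows s₀ s₂
  Grows-trans g h = record
    { uses≡      = trans (uses≡ h) (uses≡ g)
    ; marked     = marked h ∘ marked g
    ; queued     = queued h ∘ queued g
    ; fresh      = [ Sum.map₂ (queued h) ∘ fresh g , inj₂ ] ∘ fresh h
    ; potential≤ = ≤-trans (potential≤ h) (potential≤ g)
    ; sound      = sound h
    }

  -- If `t` is already marked, nothing changes. Otherwise its weight moves from the unmarked part of
  -- the potential to the queued part, so the potential does not rise.
  insert-grows : ∀ {t w} → Sound s → Derived t →
                 Grows s (inserted t w s) × Marked (inserted t w s) t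
  insert-grows {s} {t} {w} snd d with get (M s) t in eq
  ... | true  = Grows-refl snd , eq
  ... | false = record
    { uses≡      = refl
    ; marked     = marked′
    ; queued     = there
    ; fresh      = fresh′
    ; potential≤ = potential′
    ; sound      = record
      { marked = λ mk → sound-marked (fresh′ mk)
      ; queued = λ { (here refl) → d ; (there q) → Sound.queued snd q }
      }
    } , get-put (M s) t true
    where
    M′ = put (M s) t true
    marked′ : ∀ {t′} → get (M s) t′ ≡ true → get M′ t′ ≡ true
    marked′ {t′} mk with get-put-other (M s) t true t′
    ... | inj₁ refl = get-put (M s) t true
    ... | inj₂ same = trans same mk

    fresh′ : ∀ {t′} → get M′ t′ ≡ true → get (M s) t′ ≡ true ⊎ t′ ∈ t ∷ Q s
    fresh′ {t′} mk with get-put-other (M s) t true t′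
    ... | inj₁ refl = inj₂ (here refl)
    ... | inj₂ same = inj₁ (trans (sym same) mk)

    sound-marked : ∀ {t′} → get (M s) t′ ≡ true ⊎ t′ ∈ t ∷ Q s → Derived t′
    sound-marked (inj₁ mk)          = Sound.marked snd mk
    sound-marked (inj₂ (here refl)) = d
    sound-marked (inj₂ (there q))   = Sound.queued snd q

    unmarked-mono : ∀ t′ → unmarked M′ t′ ≤ unmarked (M s) t′
    unmarked-mono t′ with get (M s) t′ in e
    ... | true  rewrite marked′ e = z≤n
    ... | false with get M′ t′
    ...   | true  = z≤n
    ...   | false = ≤-refl

    gap : unmarked M′ t + weight (proj₁ t) ≤ unmarked (M s) t
    gap rewrite get-put (M s) t true | eq = ≤-refl

    potential′ : ∑ (unmarked M′) triples + (weight (proj₁ t) + ∑ (weight ∘ proj₁) (Q s))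
                 ≤ potential s
    potential′ = ≤-trans
      (≤-reflexive (sym (+-assoc (∑ (unmarked M′) triples) (weight (proj₁ t)) _)))
      (+-monoˡ-≤ (∑ (weight ∘ proj₁) (Q s))
        (∑-mono-∈ (∈-triples t) unmarked-mono gap))

  -- Each element is either still to be visited or already satisfies `R`; stability of `R` under
  -- growth carries earlier results through later iterations.
  Halts-forEach-grows : ∀ {body : X → Cmd} {K : X → Set} (R : X → State → Set) →
    (∀ {x s s′} → Grows s s′ → R x s → R x s′) →
    (∀ {x s} → K x → Sound s → Halts (λ s′ → Grows s s′ × R x s′) k (body x , s)) →
    ∀ {xs} → All K xs → Sound s →
    Halts (λ s′ → Grows s s′ × (∀ {x} → x ∈ xs → R x s′))
          (suc (length xs * (2 + k))) (forEach xs body , s)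
  Halts-forEach-grows {X} {s = s₀} R stable h {xs} K-xs snd =
    Halts-mono ≤-refl (map₂ λ r x∈ → finished (r x∈))
      (Halts-forEach I pass K-xs (Grows-refl snd , inj₁))
    where
    I : List X → State → Set
    I todo s = Grows s₀ s × (∀ {x} → x ∈ xs → x ∈ todo ⊎ R x s)

    finished : ∀ {x s} → x ∈ [] ⊎ R x s → R x s
    finished (inj₂ r) = r

    advance : ∀ {x y todo s s′} → Grows s s′ → R x s′ → y ∈ x ∷ todo ⊎ R y s → y ∈ todo ⊎ R y s′
    advance g r (inj₁ (here refl)) = inj₂ r
    advance g r (inj₁ (there y∈))  = inj₁ y∈
    advance g r (inj₂ r′)          = inj₂ (stable g r′)

    pass : ∀ {x todo s} → _ → I (x ∷ todo) s → Halts (I todo) _ (_ , s)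
    pass kx (g , r) = Halts-mono ≤-refl
      (λ (g′ , rx) → Grows-trans g g′ , λ y∈ → advance g′ rx (r y∈))
      (h kx (sound g))

  -- The index of binary rules

  lookup-indexed : ∀ A B C s X →
    Vec.lookup (uses (indexed (A , B , C) s)) X ≡
      (if ⌊ B ≟ X ⌋ ∨ ⌊ C ≟ X ⌋ then (A , B , C) ∷ Vec.lookup (uses s) X else Vec.lookup (uses s) X)
  lookup-indexed A B C s X with B ≟ C
  -- With equal right-hand symbols the rule is filed only once, in agreement with the single
  -- disjunction in the statement.
  ... | yes refl with B ≟ X
  ...   | yes refl = lookup∘updateAt B (uses s)
  ...   | no B≢X   = lookup∘updateAt′ X B (B≢X ∘ sym) (uses s)
  lookup-indexed A B C s X | no B≢C with C ≟ X | B ≟ X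
  ... | yes refl | yes refl = contradiction refl B≢C
  ... | yes refl | no B≢X   =
    trans (lookup∘updateAt C (Vec.updateAt (uses s) B _))
          (cong (_ ∷_) (lookup∘updateAt′ C B (B≢X ∘ sym) (uses s)))
  ... | no C≢X   | yes refl =
    trans (lookup∘updateAt′ B C (C≢X ∘ sym) (Vec.updateAt (uses s) B _))
          (lookup∘updateAt B (uses s))
  ... | no C≢X   | no B≢X   =
    trans (lookup∘updateAt′ X C (C≢X ∘ sym) (Vec.updateAt (uses s) B _))
          (lookup∘updateAt′ X B (B≢X ∘ sym) (uses s))

  record Indexed (todo : List (Production m σ)) (U : Vec (List BinaryRule) m) : Set where
    field
      ∈⇒production : ∀ {A B C X} → (A , B , C) ∈ Vec.lookup U X → (A ⟶ nt B ∷ nt C ∷ []) ∈ P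
      production⇒∈ : ∀ {A B C} → (A ⟶ nt B ∷ nt C ∷ []) ∈ P →
        (A ⟶ nt B ∷ nt C ∷ []) ∈ todo
        ⊎ (A , B , C) ∈ Vec.lookup U B × (A , B , C) ∈ Vec.lookup U C
      size≤ : ∀ X → length (Vec.lookup U X) + ∑ (λ p → occ p X) todo ≤ occCount X
  open Indexed

  Indexed-blank : Indexed P (uses blank)
  Indexed-blank = record
    { ∈⇒production = λ {_} {_} {_} {X} r∈ → nothing-filed X r∈
    ; production⇒∈ = inj₁
    ; size≤        = λ X → ≤-reflexive (cong (λ rs → length rs + occCount X) (lookup-replicate X []))
    }
    where
    nothing-filed : ∀ {r : BinaryRule} {Z : Set} X → r ∈ Vec.lookup (Vec.replicate m []) X → Z
    nothing-filed X r∈ = contradiction (subst (_ ∈_) (lookup-replicate X []) r∈) λ ()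

  Indexed-skip : ∀ {p todo U} → (∀ X → occ p X ≡ 0) → (∀ {A B C} → p ≢ (A ⟶ nt B ∷ nt C ∷ [])) →
                 Indexed (p ∷ todo) U → Indexed todo U
  Indexed-skip {p} {todo} {U} occ≡0 p≢ ix = record
    { ∈⇒production = ∈⇒production ix
    ; production⇒∈ = λ q → drop (production⇒∈ ix q)
    ; size≤        = λ X → ≤-trans
        (≤-reflexive (cong (λ o → length (Vec.lookup U X) + (o + ∑ (λ p → occ p X) todo)) (sym (occ≡0 X))))
        (size≤ ix X)
    }
    where
    drop : ∀ {A B C} {Z : Set} → (A ⟶ nt B ∷ nt C ∷ []) ∈ p ∷ todo ⊎ Z →
           (A ⟶ nt B ∷ nt C ∷ []) ∈ todo ⊎ Z
    drop (inj₁ (here q≡))  = contradiction (sym q≡) p≢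
    drop (inj₁ (there q∈)) = inj₁ q∈
    drop (inj₂ z)          = inj₂ z

  Indexed-add : ∀ {A B C todo} → (A ⟶ nt B ∷ nt C ∷ []) ∈ P →
                Indexed ((A ⟶ nt B ∷ nt C ∷ []) ∷ todo) (uses s) →
                Indexed todo (uses (indexed (A , B , C) s))
  Indexed-add {s} {A} {B} {C} {todo} p∈ ix = record
    { ∈⇒production = λ {_} {_} {_} {X} r∈ → old-or-new X r∈
    ; production⇒∈ = λ q → advance (production⇒∈ ix q)
    ; size≤        = λ X → ≤-trans (counted X) (size≤ ix X)
    }
    where
    U  = uses s
    U′ = uses (indexed (A , B , C) s)

    old-or-new : ∀ {A′ B′ C′} X → (A′ , B′ , C′) ∈ Vec.lookup U′ X → (A′ ⟶ nt B′ ∷ nt C′ ∷ []) ∈ P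
    old-or-new X r∈ rewrite lookup-indexed A B C s X with ⌊ B ≟ X ⌋ ∨ ⌊ C ≟ X ⌋ | r∈
    ... | true  | here refl = p∈
    ... | true  | there r∈′ = ∈⇒production ix r∈′
    ... | false | r∈′       = ∈⇒production ix r∈′

    keep : ∀ {r} X → r ∈ Vec.lookup U X → r ∈ Vec.lookup U′ X
    keep X r∈ rewrite lookup-indexed A B C s X with ⌊ B ≟ X ⌋ ∨ ⌊ C ≟ X ⌋
    ... | true  = there r∈
    ... | false = r∈

    in-B : (A , B , C) ∈ Vec.lookup U′ B
    in-B rewrite lookup-indexed A B C s B with B ≟ B
    ... | yes _  = here refl
    ... | no B≢B = contradiction refl B≢B

    in-C : (A , B , C) ∈ Vec.lookup U′ C
    in-C rewrite lookup-indexed A B C s C with B ≟ C | C ≟ C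
    ... | yes _ | _      = here refl
    ... | no _  | yes _  = here refl
    ... | no _  | no C≢C = contradiction refl C≢C

    advance : ∀ {A′ B′ C′} →
      (A′ ⟶ nt B′ ∷ nt C′ ∷ []) ∈ (A ⟶ nt B ∷ nt C ∷ []) ∷ todo
        ⊎ (A′ , B′ , C′) ∈ Vec.lookup U B′ × (A′ , B′ , C′) ∈ Vec.lookup U C′ →
      (A′ ⟶ nt B′ ∷ nt C′ ∷ []) ∈ todo
        ⊎ (A′ , B′ , C′) ∈ Vec.lookup U′ B′ × (A′ , B′ , C′) ∈ Vec.lookup U′ C′
    advance (inj₁ (here refl)) = inj₂ (in-B , in-C)
    advance (inj₁ (there q∈))  = inj₁ q∈
    advance (inj₂ (l , r))     = inj₂ (keep _ l , keep _ r)

    counted : ∀ X → length (Vec.lookup U′ X) + ∑ (λ p → occ p X) todo ≤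
                    length (Vec.lookup U X) + ([ B ≐ X ] + [ C ≐ X ] + ∑ (λ p → occ p X) todo)
    counted X rewrite lookup-indexed A B C s X with B ≟ X | C ≟ X
    -- Here `B` and `C` are both `X`: one new entry is set against two occurrences, so one unit of
    -- slack remains.
    ... | yes _ | yes _ = ≤-trans (n≤1+n _) (≤-reflexive (sym
                            (trans (+-suc _ _) (cong suc (+-suc _ _)))))
    ... | yes _ | no _  = ≤-reflexive (sym (+-suc _ _))
    ... | no _  | yes _ = ≤-reflexive (sym (+-suc _ _))
    ... | no _  | no _  = ≤-refl

  -- The individual passes and the processing of one triple

  ⌊≟⌋-true : ∀ {k} {i j : Fin k} → ⌊ i ≟ j ⌋ ≡ true → i ≡ j
  ⌊≟⌋-true {i = i} {j} _ with i ≟ j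
  ⌊≟⌋-true _  | yes i≡j = i≡j
  ⌊≟⌋-true () | no _

  ⌊≟⌋-≡ : ∀ {k} {i j : Fin k} → i ≡ j → ⌊ i ≟ j ⌋ ≡ true
  ⌊≟⌋-≡ {i = i} refl with i ≟ i
  ... | yes _  = refl
  ... | no i≢i = contradiction refl i≢i

  TerminalsMarked : State → Set
  TerminalsMarked s = ∀ {A a u v} → (A ⟶ tm a ∷ []) ∈ P → (e : (u , v) ∈ E) → label e ≡ a →
                      Marked s (A , u , v)

  EmptyMarked : State → Set
  EmptyMarked s = (S ⟶ []) ∈ P → ∀ u → Marked s (S , u , u)

  -- The alternative t₁ ∈ Q s covers a triple marked only after the loop has tested it: it
  -- is still in the queue, because nothing is dequeued while a triple is processed.
  Settled : State → Triple → Triple → Set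
  Settled s t₁ t₂ = Marked s t₁ → Marked s t₂ ⊎ t₁ ∈ Q s

  -- If `t₁` was already marked in `s₁`, the earlier alternative persists; if it was marked later,
  -- `fresh` puts it in the queue.
  Settled-grows : Grows s₁ s₂ → Settled s₁ t₁ t₂ → Settled s₂ t₁ t₂
  Settled-grows g st mk = [ Sum.map (marked g) (queued g) ∘ st , inj₂ ] (fresh g mk)

  -- The conjuncts correspond to the two sweeps, with the processed triple as left or as right
  -- premise. A rule `A → XX` requires both.
  Applied : Triple → BinaryRule → State → Set
  Applied (X , i , j) (A , B , C) s =
    (X ≡ B → ∀ k → Settled s (C , j , k) (A , i , k)) ×
    (X ≡ C → ∀ h → Settled s (B , h , i) (A , h , j))

  Applied-grows : ∀ {t r} → Grows s₁ s₂ → Applied t r s₁ → Applied t r s₂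
  Applied-grows g (l , r) = (λ e k → Settled-grows g (l e k)) , (λ e h → Settled-grows g (r e h))

  -- If the test fails, `Settled` holds vacuously at this moment; `Settled-grows` takes care of a
  -- later marking of `t₁`. The budget covers the test and the insertion.
  Halts-combine : ∀ {t₁ t₂ w} → (Derived t₁ → Derived t₂) → Sound s →
    Halts (λ s′ → Grows s s′ × Settled s′ t₁ t₂) 2 (whenM t₁ (insert t₂ w) , s)
  Halts-combine f snd = Halts-whenM
    (λ mk → let g , mk′ = insert-grows snd (f (Sound.marked snd mk)) in
            Halts-insert (g , const (inj₁ mk′)))
    (λ unmk → Grows-refl snd , λ mk → contradiction (trans (sym mk) unmk) λ ())

  Halts-sweep : ∀ {b} {t₁ t₂ : Fin n → Triple} {w} →
    (b ≡ true → ∀ k → Derived (t₁ k) → Derived (t₂ k)) → Sound s →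
    Halts (λ s′ → Grows s s′ × (b ≡ true → ∀ k → Settled s′ (t₁ k) (t₂ k)))
          (2 + n * 4) (guard b (forEach (allFin n) λ k → whenM (t₁ k) (insert (t₂ k) w)) , s)
  Halts-sweep {s} {b} {t₁} {t₂} f snd =
    Halts-mono (≤-reflexive (cong (λ l → 2 + l * 4) (length-allFin n))) id (Halts-guard
      (λ b≡ → Halts-mono ≤-refl (map₂ λ r _ k → r (∈-allFin k))
        (Halts-forEach-grows (λ k s → Settled s (t₁ k) (t₂ k)) Settled-grows
          (λ d snd′ → Halts-combine d snd′) (All.tabulate λ {k} _ → f b≡ k) snd))
      (λ b≡ → Grows-refl snd , λ b≡′ → contradiction (trans (sym b≡) b≡′) λ ()))

  labeledEdges-sound : All (λ (u , v , a) → Σ[ e ∈ (u , v) ∈ E ] label e ≡ a) (labeledEdges G)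
  labeledEdges-sound = All.tabulate λ x∈ → origin (mapWith∈⁻ E _ x∈)
    where
    origin : ∀ {x} → ∃[ e ] Σ[ e∈ ∈ e ∈ E ] x ≡ (proj₁ e , proj₂ e , label e∈) →
             Σ[ e ∈ (proj₁ x , proj₁ (proj₂ x)) ∈ E ] label e ≡ proj₂ (proj₂ x)
    origin (_ , e , refl) = e , refl

  labeledEdges-complete : ∀ {u v} (e : (u , v) ∈ E) → (u , v , label e) ∈ labeledEdges G
  labeledEdges-complete e = mapWith∈⁺ _ (_ , e , refl)

  length-labeledEdges≤ : length (labeledEdges G) ≤ n * n
  length-labeledEdges≤ =
    ≤-trans (≤-reflexive (length-mapWith∈ (setoid _) E)) (Unique⇒length≤ E-unique)

  module _ (cnf : ChomskyNormalForm 𝒢) where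

    cnf-productions : All (λ p → CNFProduction 𝒢 p × p ∈ P) P
    cnf-productions = All.tabulate λ p∈ → All.lookup cnf p∈ , p∈

    Halts-indexRules :
      Halts (λ s → M s ≡ constant false × Q s ≡ [] × Indexed [] (uses s))
            (suc (length P * 3)) (indexRules , blank)
    Halts-indexRules = Halts-forEach
      (λ todo s → M s ≡ constant false × Q s ≡ [] × Indexed todo (uses s))
      (λ { {s = s} (binary , p∈) (M≡ , Q≡ , ix) →
             step (_ , index-step) λ { index-step → done (M≡ , Q≡ , Indexed-add {s} p∈ ix) }
         ; (terminal , _) (M≡ , Q≡ , ix) →
             done (M≡ , Q≡ , Indexed-skip (λ _ → refl) (λ ()) ix)
         ; (empty , _) (M≡ , Q≡ , ix) →
             done (M≡ , Q≡ , Indexed-skip (λ _ → refl) (λ ()) ix)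
         })
      cnf-productions (refl , refl , Indexed-blank)

    Halts-terminalRules : Sound s →
      Halts (λ s′ → Grows s s′ × TerminalsMarked s′)
            (suc (length P * (3 + n * n * 4))) (terminalRules , s)
    Halts-terminalRules snd = Halts-mono ≤-refl (map₂ λ r p∈ → r p∈ refl)
      (Halts-forEach-grows
        -- The property must make sense for every production, so the shape of `p` enters as an
        -- equation, which is absurd for the two other shapes.
        (λ p s → ∀ {A a u v} → p ≡ (A ⟶ tm a ∷ []) → (e : (u , v) ∈ E) → label e ≡ a →
                 Marked s (A , u , v))
        (λ g r p≡ e l → marked g (r p≡ e l))
        (λ { (binary , _) snd → done (Grows-refl snd , λ ())
           ; (empty , _) snd → done (Grows-refl snd , λ ())
           ; (terminal {A} {a} , p∈) snd →
               Halts-mono (s≤s (*-monoˡ-≤ 4 length-labeledEdges≤))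
                 (map₂ λ { r refl e refl → r (labeledEdges-complete e) refl })
                 (Halts-forEach-grows
                   (λ (u , v , b) s → a ≡ b → Marked s (A , u , v))
                   (λ g r a≡b → marked g (r a≡b))
                   (λ (e , l) snd → Halts-guard
                     (λ a≡b → Halts-insert (map₂ const
                       (insert-grows snd (term p∈ e (trans l (sym (⌊≟⌋-true a≡b)))))))
                     (λ a≢b → Grows-refl snd ,
                              λ a≡b → contradiction (trans (sym a≢b) (⌊≟⌋-≡ a≡b)) λ ()))
                   labeledEdges-sound snd)
           })
        cnf-productions snd)

    Halts-emptyRule : Sound s →
      Halts (λ s′ → Grows s s′ × EmptyMarked s′)
            (suc (length P * (4 + n * 3))) (emptyRule , s)
    Halts-emptyRule snd = Halts-mono ≤-refl (map₂ λ r p∈ → r p∈ refl)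
      (Halts-forEach-grows
        (λ p s → p ≡ (S ⟶ []) → ∀ u → Marked s (S , u , u))
        (λ g r p≡ u → marked g (r p≡ u))
        (λ { (binary , _) snd → done (Grows-refl snd , λ ())
           ; (terminal , _) snd → done (Grows-refl snd , λ ())
           ; (empty , p∈) snd →
               Halts-mono (≤-reflexive (cong (λ l → 2 + l * 3) (length-allFin n)))
                 (map₂ λ r _ u → r u)
                 (Halts-guard
                   (λ _ → Halts-mono ≤-refl (map₂ λ r u → r (∈-allFin u))
                     (Halts-forEach-grows
                       (λ u s → Marked s (S , u , u)) (λ g → marked g)
                       (λ _ snd → Halts-insert (insert-grows snd (eps p∈)))
                       (All.tabulate {P = λ _ → (S ⟶ []) ∈ P} λ _ → p∈) snd))
                   -- In Chomsky normal form an empty production has `S` on the left, so the guard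
                   -- cannot fail.
                   (λ S≢S → contradiction (trans (sym S≢S) (⌊≟⌋-≡ {i = S} refl)) λ ()))
           })
        cnf-productions snd)

  -- The second sweep may mark partners that the first one found unmarked; growth keeps the first
  -- result valid because these are queued.
  Halts-rule : ∀ {A B C X i j} → (A ⟶ nt B ∷ nt C ∷ []) ∈ P → Derives X i j → Sound s →
    Halts (λ s′ → Grows s s′ × Applied (X , i , j) (A , B , C) s′)
          (2 + n * 4 + suc (2 + n * 4))
          ( guard ⌊ X ≟ B ⌋ (forEach (allFin n) λ k →
              whenM (C , j , k) (insert (A , i , k) (bin B C j)))
          ⨾ guard ⌊ X ≟ C ⌋ (forEach (allFin n) λ h →
              whenM (B , h , i) (insert (A , h , j) (bin B C i)))
          , s)
  Halts-rule {i = i} {j} p∈ d snd = Halts-seq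
    (Halts-sweep (λ X≡B k d′ → split p∈ (subst (λ Y → Derives Y i j) (⌊≟⌋-true X≡B) d) d′) snd)
    λ (g , l) → Halts-mono ≤-refl
      (λ (g′ , r) → Grows-trans g g′ ,
        (λ e k → Settled-grows g′ (l (⌊≟⌋-≡ e) k)) , (λ e h → r (⌊≟⌋-≡ e) h))
      (Halts-sweep
        (λ X≡C h d′ → split p∈ d′ (subst (λ Y → Derives Y i j) (⌊≟⌋-true X≡C) d)) (sound g))

  -- The rule list is read once, on entry. The leading 2 pays for that read and for the end of the
  -- loop over the list.
  Halts-process : ∀ {X i j} → Indexed [] (uses s) → Sound s → Derives X i j →
    Halts (λ s′ → Grows s s′ × (∀ {r} → r ∈ Vec.lookup (uses s) X → Applied (X , i , j) r s′))
          (2 + length (Vec.lookup (uses s) X) * ruleCost) (process (X , i , j) , s)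
  Halts-process {s} {X} {i} {j} ix snd d =
    Halts-mono (≤-reflexive (cong (λ c → 2 + length (Vec.lookup (uses s) X) * c) (cost≡ n))) id
      (Halts-forUses (Halts-forEach-grows (Applied (X , i , j)) Applied-grows
        (λ p∈ → Halts-rule p∈ d)
        (All.tabulate (∈⇒production ix)) snd))
    where
    cost≡ : ∀ n → 2 + (2 + n * 4 + suc (2 + n * 4)) ≡ 7 + 8 * n
    cost≡ = solve-∀

  -- The loop invariant and its preservation

  record Invariant (s : State) : Set where
    field
      ruleIndex : Indexed [] (uses s)
      sound     : Sound s
      terminals : TerminalsMarked s
      empties   : EmptyMarked s
      closed    : ∀ {A B C i j k} → (A ⟶ nt B ∷ nt C ∷ []) ∈ P →
                  Marked s (B , i , j) → Marked s (C , j , k) →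
                  Marked s (A , i , k) ⊎ (B , i , j) ∈ Q s ⊎ (C , j , k) ∈ Q s

  -- A derivable triple has a production for its nonterminal, so `lhsCount` is at least 1 and its
  -- factor 4 covers the fixed overhead: 2 for `process` and 2 for the loop. The filed rules are
  -- paid for through `occCount`.
  weight-affordable : ∀ {A u v} → Indexed [] (uses s) → Derives A u v →
                      2 + length (Vec.lookup (uses s) A) * ruleCost + 2 ≤ weight A
  weight-affordable {s} {A} ix d = begin
    2 + L * ruleCost + 2                     ≡⟨ regroup L ruleCost ⟩
    4 * 1 + ruleCost * (L + 0)               ≤⟨ +-mono-≤ (*-monoʳ-≤ 4 lhs-occurs)
                                                         (*-monoʳ-≤ ruleCost (size≤ ix A)) ⟩
    4 * lhsCount A + ruleCost * occCount A   ∎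
    where
    open ≤-Reasoning
    L = length (Vec.lookup (uses s) A)
    regroup : ∀ l c → 2 + l * c + 2 ≡ 4 * 1 + c * (l + 0)
    regroup = solve-∀
    lhs-occurs : 1 ≤ lhsCount A
    lhs-occurs = ≤-trans (≤-reflexive (sym ([≐]-refl A)))
      (∈⇒≤∑ {f = λ p → [ Production.lhs p ≐ A ]} (proj₂ (Derives⇒production d)))

  Invariant-dequeue : ∀ {s} ts {t} ts′ → Q s ≡ ts ++ t ∷ ts′ → Invariant s →
    Σ[ k ∈ ℕ ] Σ[ l ∈ ℕ ] k + suc (suc l) ≤ potential s ×
      Halts (λ s′ → Invariant s′ × potential s′ ≤ l) k
            (process t , record s { Q = ts ++ ts′ })
  Invariant-dequeue {s} ts {t@(X , i , j)} ts′ Q≡ inv =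
    cost , potential s⁻ , fits ,
    Halts-mono ≤-refl (λ (g , applied) → restored g applied , potential≤ g)
      (Halts-process (Invariant.ruleIndex inv) sound₀ derived)
    where
    open Invariant inv hiding (sound)
    s⁻ = record s { Q = ts ++ ts′ }

    derived : Derives X i j
    derived = Sound.queued (Invariant.sound inv) (subst (t ∈_) (sym Q≡) (∈-++⁺ʳ ts (here refl)))

    rest⊆Q : ∀ {t′} → t′ ∈ ts ++ ts′ → t′ ∈ Q s
    rest⊆Q t′∈ = subst (_ ∈_) (sym Q≡)
      ([ ∈-++⁺ˡ , ∈-++⁺ʳ ts ∘ there ] (∈-++⁻ ts t′∈))

    Q⊆t∷rest : ∀ {t′} → t′ ∈ Q s → t′ ≡ t ⊎ t′ ∈ ts ++ ts′
    Q⊆t∷rest t′∈ with ∈-++⁻ ts (subst (_ ∈_) Q≡ t′∈)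
    ... | inj₁ t′∈ts          = inj₂ (∈-++⁺ˡ t′∈ts)
    ... | inj₂ (here t′≡t)    = inj₁ t′≡t
    ... | inj₂ (there t′∈ts′) = inj₂ (∈-++⁺ʳ ts t′∈ts′)

    sound₀ : Sound s⁻
    sound₀ = record { marked = Sound.marked (Invariant.sound inv) ; queued = Sound.queued (Invariant.sound inv) ∘ rest⊆Q }

    cost : ℕ
    cost = 2 + length (Vec.lookup (uses s) X) * ruleCost

    fits : cost + suc (suc (potential s⁻)) ≤ potential s
    fits = begin
      cost + (2 + potential s⁻)     ≡⟨ +-assoc cost 2 _ ⟨
      cost + 2 + potential s⁻       ≤⟨ +-monoˡ-≤ (potential s⁻)
                                         (weight-affordable {s = s} ruleIndex derived) ⟩
      weight X + potential s⁻       ≡⟨ dequeued-potential {s} ts ts′ Q≡ ⟩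
      potential s                   ∎
      where open ≤-Reasoning

    restored : ∀ {s′} → Grows s⁻ s′ →
      (∀ {r} → r ∈ Vec.lookup (uses s) X → Applied t r s′) → Invariant s′
    restored {s′} g applied = record
      { ruleIndex = subst (Indexed []) (sym (uses≡ g)) ruleIndex
      ; sound     = Grows.sound g
      ; terminals = λ p∈ e l → marked g (terminals p∈ e l)
      ; empties   = λ p∈ u → marked g (empties p∈ u)
      ; closed    = closed′
      }
      where
      closed′ : ∀ {A B C i j k} → (A ⟶ nt B ∷ nt C ∷ []) ∈ P →
                Marked s′ (B , i , j) → Marked s′ (C , j , k) →
                Marked s′ (A , i , k) ⊎ (B , i , j) ∈ Q s′ ⊎ (C , j , k) ∈ Q s′
      -- A premise marked during processing is still queued. If both premises are older, closure
      -- before the dequeue applies, and only a premise equal to the removed triple needs a new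
      -- argument.
      closed′ p∈ b c with fresh g b | fresh g c | production⇒∈ ruleIndex p∈
      ... | inj₂ b∈ | _       | _            = inj₂ (inj₁ b∈)
      ... | inj₁ _  | inj₂ c∈ | _            = inj₂ (inj₂ c∈)
      ... | inj₁ b₀ | inj₁ c₀ | inj₂ (r∈B , r∈C) with closed p∈ b₀ c₀
      ...   | inj₁ a = inj₁ (marked g a)
      ...   | inj₂ (inj₁ b∈) with Q⊆t∷rest b∈
      -- The left premise was the removed triple, so its sweep has settled the right one: the
      -- conclusion is marked or the right premise is queued.
      ...     | inj₁ refl = Sum.map₂ inj₂ (proj₁ (applied r∈B) refl _ c)
      ...     | inj₂ b∈′  = inj₂ (inj₁ (queued g b∈′))
      closed′ p∈ b c | inj₁ b₀ | inj₁ c₀ | inj₂ (r∈B , r∈C) | inj₂ (inj₂ c∈) with Q⊆t∷rest c∈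
      ...     | inj₁ refl = Sum.map₂ inj₁ (proj₂ (applied r∈C) refl _ b)
      ...     | inj₂ c∈′  = inj₂ (inj₂ (queued g c∈′))

  Derives⇒Marked : Invariant s → Q s ≡ [] → ∀ {A u v} → Derives A u v → Marked s (A , u , v)
  Derives⇒Marked inv Q≡ (term p∈ e l)    = Invariant.terminals inv p∈ e l
  Derives⇒Marked inv Q≡ (eps p∈)         = Invariant.empties inv p∈ _
  Derives⇒Marked {s} inv Q≡ (split p∈ d₁ d₂)
    with Invariant.closed inv p∈ (Derives⇒Marked inv Q≡ d₁) (Derives⇒Marked inv Q≡ d₂)
  ... | inj₁ a = a
  ... | inj₂ q rewrite Q≡ with q
  ...   | inj₁ ()
  ...   | inj₂ ()

  -- Assembling the run and its bounds

  buildBound : ℕ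
  -- The summands are the budgets of the four phases, and the `suc` directly after each `+` pays for
  -- the `seq-skip` joining two phases. The innermost `suc` is the exit from the loop.
  buildBound = suc (length P * 3) + suc
    (suc (length P * (3 + n * n * 4)) + suc
    (suc (length P * (4 + n * 3)) + suc
    (suc saturationBound)))

  Halts-build : ChomskyNormalForm 𝒢 →
                Halts (λ s → Invariant s × Q s ≡ []) buildBound (build , blank)
  Halts-build cnf =
    Halts-seq (Halts-indexRules cnf) λ {s₁} (M≡ , Q≡ , ix) →
    Halts-seq (Halts-terminalRules cnf (sound-initial M≡ Q≡)) λ (g , terminals) →
    Halts-seq (Halts-emptyRule cnf (sound g)) λ (g′ , empties) →
    let g″ = Grows-trans g g′ in
    Halts-mono (s≤s (≤-trans (potential≤ g″) (initial-potential≤ {s₁} M≡ Q≡))) id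
      (Halts-whileQ Invariant potential Invariant-dequeue (record
        { ruleIndex = subst (Indexed []) (sym (uses≡ g″)) ix
        ; sound     = sound g′
        ; terminals = λ p∈ e l → marked g′ (terminals p∈ e l)
        ; empties   = empties
        -- Indexing leaves `M` empty and nothing has been dequeued since, so every marked premise is
        -- still in the queue.
        ; closed    = λ p∈ b _ → inj₂ (inj₁ (all-queued M≡ g″ b))
        }))
    where
    unmarked-initially : ∀ {s t} {Z : Set} → M s ≡ constant false → Marked s t → Z
    unmarked-initially {t = t} M≡ mk rewrite M≡ | get-constant false t with mk
    ... | ()

    sound-initial : ∀ {s} → M s ≡ constant false → Q s ≡ [] → Sound s
    sound-initial {s} M≡ Q≡ = record
      { marked = unmarked-initially {s} M≡
      ; queued = λ t∈ → contradiction (subst (_ ∈_) Q≡ t∈) λ () }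

    all-queued : ∀ {s s′ t} → M s ≡ constant false → Grows s s′ → Marked s′ t → t ∈ Q s′
    all-queued {s} M≡ g mk = [ unmarked-initially {s} M≡ , id ] (fresh g mk)

  -- Every lower-order monomial is absorbed into |P| n³, which requires both quantities to be
  -- positive: otherwise the right side is 0 while the fixed overhead is 7. The constant is 7 + 10 +
  -- 3 + 22 + 16.
  buildBound≤ : 1 ≤ n → 1 ≤ length P → buildBound ≤ 58 * (length P * n ^ 3)
  buildBound≤ 1≤n 1≤p = begin
    buildBound
      ≡⟨ expand (length P) n ⟩
    7 * (1 * 1) + 10 * (length P * 1) + 3 * (length P * n ^ 1) + 22 * (length P * n ^ 2)
      + 16 * (length P * n ^ 3)
      ≤⟨ +-monoˡ-≤ (16 * T) (+-mono-≤ (+-mono-≤ (+-mono-≤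
           (*-monoʳ-≤ 7 (*-mono-≤ 1≤p (power z≤n)))
           (*-monoʳ-≤ 10 (*-monoʳ-≤ (length P) (power z≤n))))
           (*-monoʳ-≤ 3 (*-monoʳ-≤ (length P) (power (s≤s z≤n)))))
           (*-monoʳ-≤ 22 (*-monoʳ-≤ (length P) (power (s≤s (s≤s z≤n)))))) ⟩
    7 * T + 10 * T + 3 * T + 22 * T + 16 * T
      ≡⟨ collect T ⟩
    58 * T ∎
    where
    open ≤-Reasoning
    T = length P * n ^ 3
    power : ∀ {i} → i ≤ 3 → n ^ i ≤ n ^ 3
    power = ^-monoʳ-≤ n {{>-nonZero 1≤n}}
    expand : ∀ p n →
      suc (p * 3) + suc (suc (p * (3 + n * n * 4)) + suc (suc (p * (4 + n * 3)) + suc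
        (suc (n * n * (4 * (p * 1) + (7 + 8 * n) * (p * 2))))))
      ≡ 7 * (1 * 1) + 10 * (p * 1) + 3 * (p * (n * 1)) + 22 * (p * (n * (n * 1)))
        + 16 * (p * (n * (n * (n * 1))))
    expand = solve-∀
    collect : ∀ T → 7 * T + 10 * T + 3 * T + 22 * T + 16 * T ≡ 58 * T
    collect = solve-∀

  -- The dimensions are part of the type of a table, so the bound holds in every state. The factor
  -- 58 is generous here and allows one constant for time and space.
  cells≤ : (T : Table X) → cells T ≤ 58 * (m * n ^ 2)
  cells≤ T = ≤-trans (≤-reflexive (trans (cells≡ T) (square m n))) (m≤n*m _ 58)
    where
    square : ∀ m n → m * n * n ≡ m * (n * (n * 1))
    square = solve-∀

  records≤ : (T : Table (Maybe Witness)) → records T ≤ 58 * (m * n ^ 2)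
  records≤ T = ≤-trans (length-catMaybes (entries T)) (cells≤ T)

theorem2p3 :
  Σ[ c ∈ ℕ ] (∀ {n σ m} (G : LabeledGraph n σ) (𝒢 : CFG m σ) → ChomskyNormalForm 𝒢 →
    let open CFG 𝒢
        open SatIndex G 𝒢
        open State
        -- M_S[s,t] holds the right answer, and the query reads it off within c steps
        Answers : State → Set
        Answers st = ∀ (s t : Fin n) →
          (get (M st) (S , s , t) ≡ true ⇔ HasPath s t)
          × Halts (λ st′ → out st′ ≡ just (get (M st) (S , s , t))) c (query s t , st)
    in
    -- termination, running time, and the queries afterwards
    (Σ[ k ∈ ℕ ] Halts Answers k (build , blank)
              × (1 ≤ n → 1 ≤ length P → k ≤ c * (length P * n ^ 3)))
    -- space throughout the run
    × (∀ {cmd st} → Star _↝_ (build , blank) (cmd , st) →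
         cells (M st) ≤ c * (m * n ^ 2) × records (W st) ≤ c * (m * n ^ 2)))
-- 58 comes from the running time of the build. It also serves as the budget of a query, which takes
-- a single transition.
theorem2p3 = 58 , λ G 𝒢 cnf →
  let open SatIndex G 𝒢
      open Reachability G 𝒢
      open Execution G 𝒢
      open Saturation G 𝒢
  in
    ( buildBound
    , Halts-mono ≤-refl
        (λ (inv , Q≡) s t →
            mk⇔ (Derives⇒path ∘ Sound.marked (Invariant.sound inv))
                (Derives⇒Marked inv Q≡ ∘ HasPath⇒Derives cnf)
          , step (_ , answer-step) λ { answer-step → done refl })
        (Halts-build cnf)
    , buildBound≤
    )
  , λ {_} {st} _ → cells≤ (State.M st) , records≤ (State.W st)
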